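{- For each fixed integer $r \geq 1$, $$AW(k;r) \leq \frac{k^{2r-1}}{(2r-1)!}\,(1+o(1)) \quad \text{as } k\to\infty .$$
   Context: A sequence of positive integers $w_1<w_2<\dots<w_n$ is an ascending wave if $w_{i+1}-w_i \geq w_i-w_{i-1}$ for $2\le i\le n-1$. For positive integers $k,r$, $AW(k;r)$ denotes the least positive integer $N$ such that every $r$-coloring of $\{1,2,\dots,N\}$ contains a $k$-term monochromatic ascending wave. -}

module Defs where

open import Data.Nat.Base as ℕ using (ℕ; suc; _∸_; _^_; _!)
open import Data.Nat.Properties using (_!≢0)
open import Data.Integer.Base using (+_)
open import Data.Rational.Base using (ℚ; 0ℚ; _/_; _<_; ∣_∣)
open import Data.Fin.Base as Fin using (Fin; toℕ)
open import Data.Vec.Functional using (Vector)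
open import Data.Product.Base using (Σ-syntax; ∃-syntax; _×_)
open import Relation.Binary.PropositionalEquality.Core using (_≡_)

-- Truncated subtraction is exact in `convex`, since w is increasing.
record AscendingWave {n : ℕ} (w : Vector ℕ n) : Set where
  field
    positive   : ∀ i → 1 ℕ.≤ w i
    increasing : ∀ i j → i Fin.< j → w i ℕ.< w j
    convex     : ∀ h i j → toℕ i ≡ suc (toℕ h) → toℕ j ≡ suc (toℕ i) →
                 w i ∸ w h ℕ.≤ w j ∸ w i

-- The element x of Fin N stands for the integer value x of {1, …, N}.
value : ∀ {N} → Fin N → ℕ
value x = suc (toℕ x)

Colouring : ℕ → ℕ → Set
Colouring r N = Fin N → Fin r

HasMonochromaticWave : ∀ {r N} → ℕ → Colouring r N → Set
HasMonochromaticWave {r} {N} k χ =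
  Σ[ x ∈ Vector (Fin N) k ]
    AscendingWave (λ i → value (x i)) × (∃[ c ] (∀ i → χ (x i) ≡ c))

Forces : (k r N : ℕ) → Set
Forces k r N = (χ : Colouring r N) → HasMonochromaticWave k χ

-- IsAW k r N says that AW(k;r) exists and equals N.
record IsAW (k r N : ℕ) : Set where
  field
    positive : 1 ℕ.≤ N
    forces   : Forces k r N
    least    : ∀ M → 1 ℕ.≤ M → Forces k r M → N ℕ.≤ M

IsLittleO1 : (ℕ → ℚ) → Set
IsLittleO1 δ = ∀ ε → 0ℚ < ε → ∃[ K ] (∀ k → K ℕ.≤ k → ∣ δ k ∣ < ε)

fromℕ : ℕ → ℚ
fromℕ n = + n / 1

powerOverFactorial : (k m : ℕ) → ℚ
powerOverFactorial k m = (+ (k ^ m) / (m !)) {{m !≢0}}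

{-# OPTIONS --safe #-}
module Submission where

-- Let reach r n + 1 be the length of an interval that forces an (n+1)-term wave
-- in every r-colouring, with last difference at most gap r n.  Given such a wave
-- of colour c ending at x with last difference d, look at the reach (r-1) (n+1) + 1
-- integers from x + d on.  If one of them has colour c, it extends the wave;
-- otherwise that window is (r-1)-coloured and contains a wave with n+2 terms.
-- Hence
--   gap r (n+1)   = gap r n + reach (r-1) (n+1),
--   reach r (n+1) = reach r n + gap r (n+1),
-- so each new colour costs two summations, and reach r n ~ n^(2r-1) / (2r-1)!.

open import Defs
open import Data.Nat.Base as ℕ using (ℕ; zero; suc; _∸_; _^_; _!; s≤s; z≤n; NonZero)
open import Data.Nat.Properties
open import Data.Nat.DivMod using (_mod_; m%n<n; m<n⇒m%n≡m)
open import Data.Nat.Tactic.RingSolver using (solve-∀)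
open import Data.Fin.Base as Fin using (Fin; toℕ; punchIn; punchOut; finToFun; funToFin)
import Data.Fin.Properties as Fin
import Data.Integer.Base as ℤ
import Data.Integer.Properties as ℤ
import Data.Rational.Base as ℚ
import Data.Rational.Properties as ℚ
import Data.Rational.Unnormalised.Base as ℚᵘ
import Data.Rational.Unnormalised.Properties as ℚᵘ
open import Data.Product.Base using (Σ-syntax; ∃; ∃-syntax; _×_; _,_)
open import Data.Vec.Functional using (Vector)
open import Function.Base using (_∘_)
open import Relation.Binary.Definitions using (DecidableEquality)
open import Relation.Binary.PropositionalEquality
open import Relation.Nullary using (Dec; yes; no; contradiction)
open import Relation.Nullary.Decidable using (map′; _×-dec_; _→-dec_)
open import Relation.Unary using (Decidable)

module _ where
  open import Data.Nat.Base using (_+_; _*_; _≤_; _<_)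

  -- Recursive bounds on window length and last difference

  reach gap : ℕ → ℕ → ℕ
  reach zero    n       = 0
  reach (suc r) zero    = 0
  reach (suc r) (suc n) = reach (suc r) n + gap (suc r) (suc n)
  gap   zero    n       = 0
  gap   (suc r) zero    = 1
  gap   (suc r) (suc n) = gap (suc r) n + reach r (suc n)

  -- A wave found with one colour fewer must also obey the bounds of the larger palette, which is
  -- what `gap-mono` supplies. The recursions refer to each other, so both claims are proved
  -- together.
  reach-mono : ∀ r n → reach r n ≤ reach (suc r) n
  gap-mono   : ∀ r n → gap r n ≤ gap (suc r) n
  reach-mono zero    n       = z≤n
  reach-mono (suc r) zero    = z≤n
  reach-mono (suc r) (suc n) = +-mono-≤ (reach-mono (suc r) n) (gap-mono (suc r) (suc n))
  gap-mono   zero    n       = z≤n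
  gap-mono   (suc r) zero    = ≤-refl
  gap-mono   (suc r) (suc n) = +-mono-≤ (gap-mono (suc r) n) (reach-mono r (suc n))

  -- Waves built term by term, and their conversion to `AscendingWave`

  -- A wave with n + 1 terms of colour c, last term x and last difference d.  A
  -- one-term wave has d = 1, so that the next term is only required to be larger.
  data Wave {A : Set} (f : ℕ → A) (c : A) : (n d x : ℕ) → Set where
    start : ∀ {x} → f x ≡ c → Wave f c 0 1 x
    snoc  : ∀ {n d x} → Wave f c n d x → ∀ {e} → d ≤ e → f (x + e) ≡ c →
            Wave f c (suc n) e (x + e)

  module _ {A : Set} {f : ℕ → A} {c : A} where

    lastDifference≥1 : ∀ {n d x} → Wave f c n d x → 1 ≤ d
    lastDifference≥1 (start _)      = ≤-refl
    lastDifference≥1 (snoc W d≤e _) = ≤-trans (lastDifference≥1 W) d≤e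

    -- Terms are indexed from the last one backwards.
    term : ∀ {n d x} → Wave f c n d x → ℕ → ℕ
    term (start {x} _)            j       = x
    term (snoc {x = x} W {e} _ _) zero    = x + e
    term (snoc W _ _)             (suc j) = term W j

    term-colour : ∀ {n d x} (W : Wave f c n d x) j → f (term W j) ≡ c
    term-colour (start fx)    j       = fx
    term-colour (snoc _ _ fx) zero    = fx
    term-colour (snoc W _ _)  (suc j) = term-colour W j

    term-zero : ∀ {n d x} (W : Wave f c n d x) → term W 0 ≡ x
    term-zero (start _)    = refl
    term-zero (snoc _ _ _) = refl

    term≤last : ∀ {n d x} (W : Wave f c n d x) j → term W j ≤ x
    term≤last (start _)    j       = ≤-refl
    term≤last (snoc _ _ _) zero    = ≤-refl
    term≤last (snoc W _ _) (suc j) = ≤-trans (term≤last W j) (m≤m+n _ _)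

    term-decreasing : ∀ {n d x} (W : Wave f c n d x) {i j} → i < j → j ≤ n → term W j < term W i
    term-decreasing (snoc W d≤e _) {zero}  {suc j} _ _ =
      ≤-<-trans (term≤last W j) (m<m+n _ (≤-trans (lastDifference≥1 W) d≤e))
    term-decreasing (snoc W _ _)   {suc i} {suc j} (s≤s i<j) (s≤s j≤n) = term-decreasing W i<j j≤n

    term-convex : ∀ {n d x} (W : Wave f c n d x) j → suc (suc j) ≤ n →
                  term W (suc j) ∸ term W (suc (suc j)) ≤ term W j ∸ term W (suc j)
    term-convex (snoc W _ _) (suc j) (s≤s j+2≤n) = term-convex W j j+2≤n
    term-convex (snoc (start _) _ _) zero (s≤s ())
    term-convex (snoc {x = y} (snoc {x = x} W {d} _ _) {e} d≤e _) zero _ = begin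
      (x + d) ∸ term W 0     ≡⟨ cong (x + d ∸_) (term-zero W) ⟩
      (x + d) ∸ x            ≡⟨ m+n∸m≡n x d ⟩
      d                      ≤⟨ d≤e ⟩
      e                      ≡⟨ m+n∸m≡n y e ⟨
      (y + e) ∸ y            ∎
      where open ≤-Reasoning

  AscendingWave-cong : ∀ {n} {u v : Vector ℕ n} → u ≗ v → AscendingWave u → AscendingWave v
  AscendingWave-cong {u = u} {v} u≗v W = record
    { positive   = λ i → subst (1 ≤_) (u≗v i) (positive i)
    ; increasing = λ i j i<j → subst₂ _<_ (u≗v i) (u≗v j) (increasing i j i<j)
    ; convex     = λ h i j p q →
        subst₂ _≤_ (cong₂ _∸_ (u≗v i) (u≗v h)) (cong₂ _∸_ (u≗v j) (u≗v i)) (convex h i j p q)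
    }
    where open AscendingWave W

  -- Position `i` from the front is position `n ∸ toℕ i` from the back. The `suc` matches `value`:
  -- integers count from 0 here.
  term-ascendingWave : ∀ {A : Set} {f : ℕ → A} {c n d x} (W : Wave f c n d x) →
                       AscendingWave {suc n} (λ i → suc (term W (n ∸ toℕ i)))
  term-ascendingWave {n = n} W = record
    { positive   = λ _ → s≤s z≤n
    ; increasing = λ i j i<j →
        s≤s (term-decreasing W (∸-monoʳ-< i<j (Fin.toℕ≤pred[n] j)) (m∸n≤m n (toℕ i)))
    ; convex     = λ h i j i≡1+h j≡1+i → convex i≡1+h j≡1+i (Fin.toℕ≤pred[n] j)
    }
    where
    convex : ∀ {h i j} → i ≡ suc h → j ≡ suc i → j ≤ n →
             suc (term W (n ∸ i)) ∸ suc (term W (n ∸ h)) ≤ suc (term W (n ∸ j)) ∸ suc (term W (n ∸ i))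
    convex {h} refl refl j≤n =
      -- Since `j≤n`, the subtractions `n ∸ suc h` and `n ∸ h` are the first and second successors
      -- of `n ∸ suc (suc h)`, the form that `term-convex` expects.
      subst₂ (λ a b → term W a ∸ term W b ≤ term W (n ∸ suc (suc h)) ∸ term W a)
        (sym (+-∸-assoc 1 j≤n)) (sym (+-∸-assoc 2 j≤n))
        (term-convex W (n ∸ suc (suc h)) (subst (_≤ n) (+-∸-assoc 2 j≤n) (m∸n≤m n h)))

  -- Forcing a wave by induction on colours and terms

  -- The palette g lists the admissible colours, possibly with repetitions, so that
  -- a colour is discarded by composing with punchIn.
  wave-exists : ∀ {A : Set} (_≟_ : DecidableEquality A) (f : ℕ → A) r n (g : Fin r → A) s →
                (∀ x → s ≤ x → x ≤ s + reach r n → ∃[ i ] f x ≡ g i) →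
                ∃[ i ] ∃[ d ] ∃[ x ]
                  (Wave f (g i) n d x × d ≤ gap r n × s ≤ x × x ≤ s + reach r n)
  -- With no colour left, the point `s` alone contradicts the palette.
  wave-exists _≟_ f zero n g s palette with () , _ ← palette s ≤-refl (m≤m+n s _)
  wave-exists _≟_ f (suc r) zero g s palette
    with i , fs≡gi ← palette s ≤-refl (m≤m+n s _) =
    i , 1 , s , start fs≡gi , ≤-refl , ≤-refl , m≤m+n s _
  wave-exists _≟_ f (suc r) (suc n) g s palette
    with i , d , x , W , d≤gap , s≤x , x≤ ← wave-exists _≟_ f (suc r) n g s
           (λ x s≤x x≤ → palette x s≤x (≤-trans x≤ (+-monoʳ-≤ s (m≤m+n _ _))))
    -- The offset `j` runs from 0 to `reach r (suc n)`, so the new difference `d + j` lies between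
    -- `d` and `gap (suc r) (suc n)`.
    with anyUpTo? (λ j → f (x + (d + j)) ≟ g i) (suc (reach r (suc n)))
  ... | yes (j , s≤s j≤ , fx≡gi) =
    i , d + j , x + (d + j) , snoc W (m≤m+n d j) fx≡gi , +-mono-≤ d≤gap j≤ ,
    ≤-trans s≤x (m≤m+n x _) ,
    ≤-trans (+-mono-≤ x≤ (+-mono-≤ d≤gap j≤)) (≤-reflexive (+-assoc s _ _))
  -- The window avoids the colour `g i`, so index `i` is dropped and a whole new wave is sought
  -- inside the window.
  ... | no ¬c =
    let i′ , d′ , x′ , W′ , d′≤ , ≤x′ , x′≤ =
          wave-exists _≟_ f r (suc n) (g ∘ punchIn i) (x + d) palette′
    in punchIn i i′ , d′ , x′ , W′ , ≤-trans d′≤ (gap-mono r (suc n)) ,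
       ≤-trans s≤t ≤x′ , ≤-trans x′≤ t+reach≤
    where
    s≤t : s ≤ x + d
    s≤t = ≤-trans s≤x (m≤m+n x d)

    t+reach≤ : (x + d) + reach r (suc n) ≤ s + reach (suc r) (suc n)
    t+reach≤ = begin
      (x + d) + reach r (suc n)                     ≡⟨ +-assoc x d _ ⟩
      x + (d + reach r (suc n))                     ≤⟨ +-mono-≤ x≤ (+-monoˡ-≤ _ d≤gap) ⟩
      (s + reach (suc r) n) + gap (suc r) (suc n)   ≡⟨ +-assoc s _ _ ⟩
      s + reach (suc r) (suc n)                     ∎
      where open ≤-Reasoning

    palette′ : ∀ y → x + d ≤ y → y ≤ (x + d) + reach r (suc n) → ∃[ i′ ] f y ≡ g (punchIn i i′)
    palette′ y t≤y y≤
      with i″ , fy≡gi″ ← palette y (≤-trans s≤t t≤y) (≤-trans y≤ t+reach≤) =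
      punchOut i≢i″ , trans fy≡gi″ (cong g (sym (Fin.punchIn-punchOut i≢i″)))
      where
      j = y ∸ (x + d)
      y≡ : x + (d + j) ≡ y
      y≡ = trans (sym (+-assoc x d j)) (m+[n∸m]≡n t≤y)
      i≢i″ : i ≢ i″
      i≢i″ refl = ¬c (j , s≤s (m≤n+o⇒m∸n≤o y (x + d) y≤) , trans (cong f y≡) fy≡gi″)

  forces : ∀ r n → Forces (suc n) r (suc (reach r n))
  forces r n χ
    -- The colouring is extended periodically to all of ℕ. The wave found stays within `0` to
    -- `reach r n`, where reduction modulo `suc (reach r n)` is the identity.
    with i , _ , x , W , _ , _ , x≤ ← wave-exists Fin._≟_ (λ x → χ (x mod suc (reach r n))) r n
           (λ i → i) 0 (λ x _ _ → _ , refl) =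
    (λ j → term W (n ∸ toℕ j) mod suc (reach r n)) ,
    AscendingWave-cong (λ j → cong suc (sym (toℕ-mod (≤-trans (term≤last W (n ∸ toℕ j)) x≤))))
      (term-ascendingWave W) ,
    i , λ j → term-colour W (n ∸ toℕ j)
    where
    toℕ-mod : ∀ {x m} → x ≤ m → toℕ (x mod suc m) ≡ x
    toℕ-mod {x} {m} x≤m = trans (Fin.toℕ-fromℕ< (m%n<n x (suc m))) (m<n⇒m%n≡m (s≤s x≤m))

  -- Decidability of `Forces` and existence of the least N

  module _ {m n} {P : (Fin m → Fin n) → Set} (P-cong : ∀ {f g} → f ≗ g → P f → P g)
           (P? : Decidable P) where

    -- Functions are enumerated through their codes in `Fin (n ^ m)`. Decoding recovers a function
    -- only pointwise, hence `P-cong`.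
    ∃-function? : Dec (∃ P)
    ∃-function? = map′
      (λ (i , Pi) → finToFun i , Pi)
      (λ (f , Pf) → funToFin f , P-cong (sym ∘ Fin.finToFun-funToFin f) Pf)
      (Fin.any? (P? ∘ finToFun))

    ∀-function? : Dec (∀ f → P f)
    ∀-function? = map′
      (λ ∀P f → P-cong (Fin.finToFun-funToFin f) (∀P (funToFin f)))
      (λ ∀P → ∀P ∘ finToFun)
      (Fin.all? (P? ∘ finToFun))

  ascendingWave? : ∀ {n} → Decidable (AscendingWave {n})
  ascendingWave? w = map′
    (λ (p , i , c) → record { positive = p ; increasing = i ; convex = c })
    (λ W → let open AscendingWave W in positive , increasing , convex)
    (Fin.all? (λ i → 1 ≤? w i) ×-dec
     Fin.all? (λ i → Fin.all? λ j → (i Fin.<? j) →-dec (w i <? w j)) ×-dec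
     Fin.all? (λ h → Fin.all? λ i → Fin.all? λ j →
       (toℕ i ≟ suc (toℕ h)) →-dec (toℕ j ≟ suc (toℕ i)) →-dec (w i ∸ w h ≤? w j ∸ w i)))

  hasMonochromaticWave? : ∀ {r N} k → Decidable (HasMonochromaticWave {r} {N} k)
  hasMonochromaticWave? k χ = ∃-function?
    (λ x≗y (W , c , χ≡c) →
      AscendingWave-cong (cong value ∘ x≗y) W ,
      c , λ i → trans (cong χ (sym (x≗y i))) (χ≡c i))
    (λ x → ascendingWave? (value ∘ x) ×-dec Fin.any? λ c → Fin.all? λ i → χ (x i) Fin.≟ c)

  forces? : ∀ k r N → Dec (Forces k r N)
  forces? k r N = ∀-function?
    (λ χ≗ψ (x , W , c , χ≡c) → x , W , c , λ i → trans (sym (χ≗ψ (x i))) (χ≡c i))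
    (hasMonochromaticWave? k)

  minimum : ∀ {P : ℕ → Set} → Decidable P → ∀ {n} → P n → ∃[ m ] (P m × ∀ j → P j → m ≤ j)
  minimum P? {zero}  p = 0 , p , λ _ _ → z≤n
  minimum P? {suc n} p with P? 0
  ... | yes p₀ = 0 , p₀ , λ _ _ → z≤n
  ... | no ¬p₀ =
    let m , pm , least = minimum (P? ∘ suc) p
    in suc m , pm , λ { zero p₀ → contradiction p₀ ¬p₀ ; (suc j) pj → s≤s (least j pj) }

  AW-exists : ∀ r n → ∃[ N ] (IsAW (suc n) r N × N ≤ suc (reach r n))
  AW-exists r n =
    -- Searching for the predecessor of N builds in positivity.
    let m , forces-m , least = minimum (forces? (suc n) r ∘ suc) (forces r n)
    in suc m ,
       record { positive = s≤s z≤n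
              ; forces   = forces-m
              ; least    = λ { (suc M) _ F → s≤s (least M F) } } ,
       s≤s (least (reach r n) (forces r n))

  -- Polynomial bounds for the recursions

  n!≤n^n : ∀ n → n ! ≤ n ^ n
  n!≤n^n zero    = ≤-refl
  n!≤n^n (suc n) = *-monoʳ-≤ (suc n) (≤-trans (n!≤n^n n) (^-monoˡ-≤ n (n≤1+n n)))

  -- The left side consists of the two leading terms of the binomial expansion of the right side.
  power-increment : ∀ x m → x ^ suc m + suc m * x ^ m ≤ suc x ^ suc m
  power-increment x zero    = ≤-reflexive (base x)
    where
    base : ∀ x → x * 1 + 1 * 1 ≡ suc x * 1
    base = solve-∀
  power-increment x (suc m) = begin
    x ^ suc (suc m) + suc (suc m) * x ^ suc m             ≤⟨ m≤m+n _ (suc m * x ^ m) ⟩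
    x ^ suc (suc m) + suc (suc m) * x ^ suc m + suc m * x ^ m
                                                          ≡⟨ expand x m (x ^ m) ⟩
    suc x * (x ^ suc m + suc m * x ^ m)                   ≤⟨ *-monoʳ-≤ (suc x) (power-increment x m) ⟩
    suc x ^ suc (suc m)                                   ∎
    where
    open ≤-Reasoning
    expand : ∀ x m p → x * (x * p) + suc (suc m) * (x * p) + suc m * p ≡ suc x * (x * p + suc m * p)
    expand = solve-∀

  -- Discrete integration: summing raises the degree by one and divides by the new degree. The shift
  -- in the base makes the bounds on `a n` and `b (suc n)` share the base `n + suc m`, so
  -- `power-increment` applies. The condition at 0 covers both `gap`, starting at 1, and `reach`,
  -- starting at 0.
  summation-bound : ∀ (a b : ℕ → ℕ) m → a 0 ≤ 1 → (∀ n → a (suc n) ≡ a n + b (suc n)) →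
                    (∀ n → b n * m ! ≤ (n + m) ^ m) →
                    ∀ n → a n * suc m ! ≤ (n + suc m) ^ suc m
  summation-bound a b m a₀≤1 a-step b≤ zero = begin
    a 0 * suc m !   ≤⟨ *-monoˡ-≤ (suc m !) a₀≤1 ⟩
    1 * suc m !     ≡⟨ *-identityˡ _ ⟩
    suc m !         ≤⟨ n!≤n^n (suc m) ⟩
    suc m ^ suc m   ∎
    where open ≤-Reasoning
  summation-bound a b m a₀≤1 a-step b≤ (suc n) = begin
    a (suc n) * suc m !                               ≡⟨ cong (_* suc m !) (a-step n) ⟩
    (a n + b (suc n)) * suc m !                       ≡⟨ distribute (a n) (b (suc n)) (suc m) (m !) ⟩
    a n * suc m ! + suc m * (b (suc n) * m !)         ≤⟨ +-mono-≤ (summation-bound a b m a₀≤1 a-step b≤ n)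
                                                                   (*-monoʳ-≤ (suc m) (b≤ (suc n))) ⟩
    (n + suc m) ^ suc m + suc m * (suc n + m) ^ m     ≡⟨ cong (λ x → (n + suc m) ^ suc m + suc m * x ^ m)
                                                              (sym (+-suc n m)) ⟩
    (n + suc m) ^ suc m + suc m * (n + suc m) ^ m     ≤⟨ power-increment (n + suc m) m ⟩
    (suc n + suc m) ^ suc m                           ∎
    where
    open ≤-Reasoning
    distribute : ∀ a b s p → (a + b) * (s * p) ≡ a * (s * p) + s * (b * p)
    distribute = solve-∀

  -- For one colour `gap` is constantly 1; from there `reach` and `gap` alternate, each gaining one
  -- degree by `summation-bound`.
  gap-bound   : ∀ r n → gap (suc r) n * (r * 2) ! ≤ (n + r * 2) ^ (r * 2)
  reach-bound : ∀ r n → reach (suc r) n * suc (r * 2) ! ≤ (n + suc (r * 2)) ^ suc (r * 2)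
  gap-bound zero zero    = ≤-refl
  gap-bound zero (suc n) = subst (λ g → g * 1 ≤ 1) (sym (+-identityʳ (gap 1 n))) (gap-bound zero n)
  gap-bound (suc r) n =
    summation-bound (gap (suc (suc r))) (reach (suc r)) (suc (r * 2)) ≤-refl (λ _ → refl) (reach-bound r) n
  reach-bound r n =
    summation-bound (reach (suc r)) (gap (suc r)) (r * 2) z≤n (λ _ → refl) (gap-bound r) n

  -- This is `(k + a) ^ m = k ^ m (1 + O(1/k))`, multiplied by `k` to stay in ℕ.
  shifted-power-bound : ∀ a m → ∃[ C ] (∀ k → 1 ≤ k → (k + a) ^ m * k ≤ k ^ m * (k + C))
  shifted-power-bound a zero    = 0 , λ k _ → *-monoʳ-≤ 1 (m≤m+n k 0)
  shifted-power-bound a (suc m) with C , bound ← shifted-power-bound a m =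
    a + C + a * C , λ k 1≤k → begin
      (k + a) ^ suc m * k                               ≡⟨ *-assoc (k + a) _ k ⟩
      (k + a) * ((k + a) ^ m * k)                       ≤⟨ *-monoʳ-≤ (k + a) (bound k 1≤k) ⟩
      (k + a) * (k ^ m * (k + C))                       ≡⟨ expand k a C (k ^ m) ⟩
      k ^ m * (k * (k + (a + C)) + 1 * (a * C))         ≤⟨ *-monoʳ-≤ (k ^ m) (+-monoʳ-≤ (k * (k + (a + C)))
                                                             (*-monoˡ-≤ (a * C) 1≤k)) ⟩
      k ^ m * (k * (k + (a + C)) + k * (a * C))         ≡⟨ collect k a C (k ^ m) ⟩
      k ^ suc m * (k + (a + C + a * C))                 ∎
    where
    open ≤-Reasoning
    expand : ∀ k a C p → (k + a) * (p * (k + C)) ≡ p * (k * (k + (a + C)) + 1 * (a * C))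
    expand = solve-∀
    collect : ∀ k a C p → p * (k * (k + (a + C)) + k * (a * C)) ≡ k * p * (k + (a + C + a * C))
    collect = solve-∀

  -- The additive m ! accounts for the 1 in N ≤ reach + 1.
  reach-asymptotics : ∀ r → let m = suc (r * 2) in
    ∃[ C ] (∀ n → suc (reach (suc r) n) * m ! * suc n ≤ suc n ^ m * (suc n + C))
  reach-asymptotics r with C , bound ← shifted-power-bound (suc (r * 2)) (suc (r * 2)) =
    C + m ! , λ n → let k = suc n in begin
      suc (reach (suc r) n) * m ! * k             ≡⟨ *-distribʳ-+ k (m !) _ ⟩
      m ! * k + reach (suc r) n * m ! * k         ≤⟨ +-mono-≤ (*-monoʳ-≤ (m !) (m≤m*n k (k ^ (r * 2)) {{m^n≢0 k (r * 2)}}))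
                                                       (*-monoˡ-≤ k (≤-trans (reach-bound r n)
                                                         (^-monoˡ-≤ m (+-monoˡ-≤ m (n≤1+n n))))) ⟩
      m ! * k ^ m + (k + m) ^ m * k               ≤⟨ +-monoʳ-≤ (m ! * k ^ m) (bound k (s≤s z≤n)) ⟩
      m ! * k ^ m + k ^ m * (k + C)               ≡⟨ collect (m !) (k ^ m) k C ⟩
      k ^ m * (k + (C + m !))                     ∎
    where
    open ≤-Reasoning
    m = suc (r * 2)
    collect : ∀ f p k C → f * p + p * (k + C) ≡ p * (k + (C + f))
    collect = solve-∀

-- Passage to the rationals and the error term

open import Data.Rational.Base using (ℚ; 1ℚ; _+_; _*_; _≤_)

toℚᵘ-/ : ∀ i d → ℚ.toℚᵘ (i ℚ./ suc d) ℚᵘ.≃ ℚᵘ.mkℚᵘ i d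
toℚᵘ-/ i d = ℚ.toℚᵘ-fromℚᵘ (ℚᵘ.mkℚᵘ i d)

-- The error is `C / k`; its value at `k = 0` is a mere default.
relativeError : ℕ → ℕ → ℚ
relativeError C zero    = ℚ.0ℚ
relativeError C (suc n) = ℤ.+ C ℚ./ suc n

relativeError-littleO : ∀ C → IsLittleO1 (relativeError C)
relativeError-littleO C (ℚ.mkℚ (ℤ.+ 0) d _) (ℚ.*<* (ℤ.+<+ ()))
relativeError-littleO C (ℚ.mkℚ ℤ.-[1+ a ] d _) (ℚ.*<* ())
-- Since ε is at least `1 / suc d`, any `k` above `C * suc d` gives `C / k < ε`.
relativeError-littleO C ε@(ℚ.mkℚ ℤ.+[1+ a ] d _) _ = suc (C ℕ.* suc d) , small
  where
  small : ∀ k → suc (C ℕ.* suc d) ℕ.≤ k → ℚ.∣ relativeError C k ∣ ℚ.< ε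
  small (suc n) C[1+d]<k = subst (ℚ._< ε) (sym (ℚ.0≤p⇒∣p∣≡p 0≤C/k)) C/k<ε
    where
    0≤C/k : ℚ.0ℚ ≤ ℤ.+ C ℚ./ suc n
    0≤C/k = ℚ.nonNegative⁻¹ _ {{ℚ.normalize-nonNeg C (suc n)}}
    C/k<ε : ℤ.+ C ℚ./ suc n ℚ.< ε
    C/k<ε = ℚ.toℚᵘ-cancel-< (ℚᵘ.<-respˡ-≃ (ℚᵘ.≃-sym (toℚᵘ-/ (ℤ.+ C) n))
      (ℚᵘ.*<* (subst₂ ℤ._<_ (ℤ.pos-* C (suc d)) (ℤ.pos-* (suc a) (suc n))
        (ℤ.+<+ (<-≤-trans C[1+d]<k (m≤m+n (suc n) (a ℕ.* suc n)))))))

-- The hypothesis is the conclusion with denominators cleared. The comparison takes place in `ℚᵘ`,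
-- where fractions are not reduced and cross-multiplication is direct.
≤-power-estimate : ∀ N p d .{{_ : NonZero d}} C n →
  N ℕ.* d ℕ.* suc n ℕ.≤ p ℕ.* (suc n ℕ.+ C) →
  fromℕ N ≤ (ℤ.+ p ℚ./ d) * (1ℚ + relativeError C (suc n))
≤-power-estimate N p (suc d) C n le = ℚ.toℚᵘ-cancel-≤
  (ℚᵘ.≤-respˡ-≃ (ℚᵘ.≃-sym (toℚᵘ-/ (ℤ.+ N) 0)) (ℚᵘ.≤-respʳ-≃ (ℚᵘ.≃-sym rhs) (ℚᵘ.*≤* cross)))
  where
  rhs : ℚ.toℚᵘ ((ℤ.+ p ℚ./ suc d) * (1ℚ + ℤ.+ C ℚ./ suc n))
        ℚᵘ.≃ ℚᵘ.mkℚᵘ (ℤ.+ p) d ℚᵘ.* (ℚᵘ.1ℚᵘ ℚᵘ.+ ℚᵘ.mkℚᵘ (ℤ.+ C) n)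
  rhs = ℚᵘ.≃-trans (ℚ.toℚᵘ-homo-* (ℤ.+ p ℚ./ suc d) (1ℚ + ℤ.+ C ℚ./ suc n))
    (ℚᵘ.*-cong (toℚᵘ-/ (ℤ.+ p) d)
      (ℚᵘ.≃-trans (ℚ.toℚᵘ-homo-+ 1ℚ (ℤ.+ C ℚ./ suc n))
        (ℚᵘ.+-congʳ ℚᵘ.1ℚᵘ (toℚᵘ-/ (ℤ.+ C) n))))
  q = ℚᵘ.mkℚᵘ (ℤ.+ p) d ℚᵘ.* (ℚᵘ.1ℚᵘ ℚᵘ.+ ℚᵘ.mkℚᵘ (ℤ.+ C) n)
  cross : ℤ.+ N ℤ.* ℚᵘ.↧ q ℤ.≤ ℚᵘ.↥ q ℤ.* ℤ.+ 1
  cross = subst₂ ℤ._≤_ denominator numerator (ℤ.+≤+ le)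
    where
    denominator : ℤ.+ (N ℕ.* suc d ℕ.* suc n) ≡ ℤ.+ N ℤ.* ℚᵘ.↧ q
    denominator = trans
      (cong ℤ.+_ (trans (*-assoc N (suc d) (suc n))
        (cong (λ k → N ℕ.* (suc d ℕ.* k)) (sym (*-identityˡ (suc n))))))
      (ℤ.pos-* N _)
    numerator : ℤ.+ (p ℕ.* (suc n ℕ.+ C)) ≡ ℚᵘ.↥ q ℤ.* ℤ.+ 1
    numerator = trans (ℤ.pos-* p (suc n ℕ.+ C)) (trans
      (cong (ℤ.+ p ℤ.*_) (trans (ℤ.pos-+ (suc n) C)
        (sym (cong₂ ℤ._+_ (ℤ.*-identityˡ (ℤ.+ suc n)) (ℤ.*-identityʳ (ℤ.+ C))))))
      (sym (ℤ.*-identityʳ (ℚᵘ.↥ q))))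

theorem1 : ∀ (r : ℕ) → 1 ℕ.≤ r →
    Σ[ δ ∈ (ℕ → ℚ) ] IsLittleO1 δ ×
    (∀ (k : ℕ) → 1 ℕ.≤ k →
    ∃[ N ] (IsAW k r N ×
    fromℕ N ≤ powerOverFactorial k (2 ℕ.* r ∸ 1) * (1ℚ + δ k)))
theorem1 (suc r) _ with C , bound ← reach-asymptotics r =
  relativeError C , relativeError-littleO C , λ where
    (suc n) _ → let N , isAW , N≤ = AW-exists (suc r) n in
      N , isAW ,
      subst (λ m → fromℕ N ≤ powerOverFactorial (suc n) m * (1ℚ + relativeError C (suc n)))
        -- The exponent `suc (r * 2)` of the bounds is `suc r * 2 ∸ 1` by computation.
        (cong (_∸ 1) (*-comm (suc r) 2))
        (≤-power-estimate N (suc n ^ suc (r ℕ.* 2)) (suc (r ℕ.* 2) !) {{suc (r ℕ.* 2) !≢0}} C n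
          (≤-trans (*-monoˡ-≤ (suc n) (*-monoˡ-≤ (suc (r ℕ.* 2) !) N≤)) (bound n)))
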